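{- Let $L$ be a finite semidistrim lattice and $x\in L$. Then $\mathsf{Row}_L(x)\le x$ if and only if $\mathcal{D}_L(x)$ is an independent dominating set of $\widetilde G_L$. Consequently, $|\{x\in L:\mathsf{Row}_L(x)\le x\}|=|\mathsf{Pop}^\downarrow_L(L)|=|\mathsf{Pop}^\uparrow_L(L)|=|\mathrm{Ind}^{\mathrm{dom}}(\widetilde G_L)|$.
   Context: All lattices are finite. For a lattice $L$, $\mathcal{J}_L$ (resp. $\mathcal{M}_L$) is the set of join-irreducible (resp. meet-irreducible) elements; for $j\in\mathcal{J}_L$, $j_*$ is the unique element covered by $j$, and for $m\in\mathcal{M}_L$, $m^*$ is the unique element covering $m$. Let $\mathcal{M}_L(j)=\max\{z\in L: j_*=j\wedge z\}$ and $\mathcal{J}_L(m)=\min\{z\in L: m^*=m\vee z\}$. A pairing on $L$ is a bijection $\kappa:\mathcal{J}_L\to\mathcal{M}_L$ with $\kappa(j)\in\mathcal{M}_L(j)$ for all $j$ and $\kappa^{ -1}(m)\in\mathcal{J}_L(m)$ for all $m$; $L$ is uniquely paired if it has exactly one pairing, denoted $\kappa_L$. A prime pair is a pair $(j_0,m_0)$ with $L=[\hat0,m_0]\sqcup[j_0,\hat1]$. A uniquely paired lattice $L$ is compatibly dismantlable if $|L|=1$ or there is a prime pair $(j_0,m_0)$ such that: (i) $[j_0,\hat1]$ is compatibly dismantlable and $\alpha(j)=j_0\vee j$ defines a bijection $\{j\in\mathcal{J}_L: j_0\le\kappa_L(j)\}\to\mathcal{J}_{[j_0,\hat1]}$ with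 $\kappa_{[j_0,\hat1]}(\alpha(j))=\kappa_L(j)$; (ii) $[\hat0,m_0]$ is compatibly dismantlable and $\beta(m)=m_0\wedge m$ defines a bijection $\{m\in\mathcal{M}_L:\kappa_L^{ -1}(m)\le m_0\}\to\mathcal{M}_{[\hat0,m_0]}$ with $\kappa_{[\hat0,m_0]}^{ -1}(\beta(m))=\kappa_L^{ -1}(m)$. The Galois graph $G_L$ is the directed graph on $\mathcal{J}_L$ with an edge $j\to j'$ iff $j\ne j'$ and $j\not\le\kappa_L(j')$; $\widetilde G_L$ is the undirected simple graph obtained by forgetting edge orientations. For $x\in L$ let $J_L(x)=\{j\in\mathcal{J}_L:j\le x\}$ and $M_L(x)=\{j\in\mathcal{J}_L:\kappa_L(j)\ge x\}$. For a compatibly dismantlable $L$, for every cover $x\lessdot y$ the set $M_L(x)\cap J_L(y)$ has exactly one element $j_{xy}$; set $\mathcal{D}_L(x)=\{j_{yx}:y\lessdot x\}$ and $\mathcal{U}_L(x)=\{j_{xy}:x\lessdot y\}$. $L$ is semidistrim if it is compatibly dismantlable and $\mathcal{D}_L(x)$, $\mathcal{U}_L(x)$ are independent sets (no two elements adjacent) of $G_L$ for all $x\in L$. For semidistrim $L$, the maps $\mathcal{D}_L$ and $\mathcal{U}_L$ are bijections from $L$ to the set of independent sets of $G_L$, and rowmotion $\mathsf{Row}_L:L\to L$ is the bijection defined by $\mathcal{U}_L(\mathsf{Row}_L(x))=\mathcal{D}_L(x)$. $\mathsf{Pop}^\downarrow_L(x)=x\wedge\bigwedge\{y:y\lessdot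 x\}$ and $\mathsf{Pop}^\uparrow_L(x)=x\vee\bigvee\{y:x\lessdot y\}$, with images $\mathsf{Pop}^\downarrow_L(L)$, $\mathsf{Pop}^\uparrow_L(L)$. In an undirected graph, a set $I$ of vertices is dominating if every vertex is in $I$ or adjacent to a vertex of $I$; $\mathrm{Ind}^{\mathrm{dom}}(G)$ is the set of independent dominating sets of $G$. -}

module Defs where

open import Data.Nat using (ℕ; zero; suc; _≡ᵇ_)
open import Data.Bool using (Bool; true; false; T; not; if_then_else_)
  renaming (_∧_ to _&&_; _∨_ to _||_)
open import Data.Fin using (Fin)
import Data.Fin as Fin
open import Data.List using (List; []; _∷_; _++_; map; length; allFin; foldr; filterᵇ)
open import Data.Bool.ListAction using (any; all)
open import Data.Vec using (Vec; tabulate; lookup)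
import Data.Vec as Vec
import Data.Vec.Properties as VecP
import Data.Bool as B
open import Data.Product using (Σ; ∃; _×_; _,_; proj₁; proj₂)
open import Data.Sum using (_⊎_)
open import Relation.Nullary using (¬_; yes; no)
open import Relation.Nullary.Decidable using (⌊_⌋)
open import Relation.Binary.PropositionalEquality using (_≡_)

record FiniteLattice : Set where
  field
    n        : ℕ
    _≤ᵇ_     : Fin n → Fin n → Bool
    ≤-refl   : ∀ x → T (x ≤ᵇ x)
    ≤-antisym : ∀ x y → T (x ≤ᵇ y) → T (y ≤ᵇ x) → x ≡ y
    ≤-trans  : ∀ x y z → T (x ≤ᵇ y) → T (y ≤ᵇ z) → T (x ≤ᵇ z)
    _∧_      : Fin n → Fin n → Fin n
    _∨_      : Fin n → Fin n → Fin n
    ∧-lb₁    : ∀ x y → T ((x ∧ y) ≤ᵇ x)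
    ∧-lb₂    : ∀ x y → T ((x ∧ y) ≤ᵇ y)
    ∧-glb    : ∀ x y z → T (z ≤ᵇ x) → T (z ≤ᵇ y) → T (z ≤ᵇ (x ∧ y))
    ∨-ub₁    : ∀ x y → T (x ≤ᵇ (x ∨ y))
    ∨-ub₂    : ∀ x y → T (y ≤ᵇ (x ∨ y))
    ∨-lub    : ∀ x y z → T (x ≤ᵇ z) → T (y ≤ᵇ z) → T ((x ∨ y) ≤ᵇ z)
    ⊥        : Fin n
    ⊤        : Fin n
    ⊥-min    : ∀ x → T (⊥ ≤ᵇ x)
    ⊤-max    : ∀ x → T (x ≤ᵇ ⊤)

countᵇ : {A : Set} → (A → Bool) → List A → ℕ
countᵇ p xs = length (filterᵇ p xs)

allSubsets : (n : ℕ) → List (Vec Bool n)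
allSubsets zero    = Vec.[] ∷ []
allSubsets (suc n) = map (true Vec.∷_) (allSubsets n) ++ map (false Vec.∷_) (allSubsets n)

module LatticeTheory (L : FiniteLattice) where
  open FiniteLattice L public

  C : Set
  C = Fin n

  _≤_ : C → C → Set
  x ≤ y = T (x ≤ᵇ y)

  elems : List C
  elems = allFin n

  anyF : (C → Bool) → Bool
  anyF p = any p elems

  allF : (C → Bool) → Bool
  allF p = all p elems

  _==_ : C → C → Bool
  x == y = ⌊ x Fin.≟ y ⌋

  _<ᵇ_ : C → C → Bool
  x <ᵇ y = (x ≤ᵇ y) && not (x == y)

  _⋖ᵇ_ : C → C → Bool
  x ⋖ᵇ y = (x <ᵇ y) && not (anyF (λ z → (x <ᵇ z) && (z <ᵇ y)))

  -- Everything below is relative to the interval [a , b] of L, viewed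
  -- as a lattice with the induced order (meets, joins and covers of
  -- elements of [a , b] are the same as in L).

  inI : C → C → C → Bool
  inI a b x = (a ≤ᵇ x) && (x ≤ᵇ b)

  lowerCovers : C → C → List C
  lowerCovers a j = filterᵇ (λ y → (a ≤ᵇ y) && (y ⋖ᵇ j)) elems

  upperCovers : C → C → List C
  upperCovers b m = filterᵇ (λ y → (y ≤ᵇ b) && (m ⋖ᵇ y)) elems

  isJ : C → C → C → Bool
  isJ a b j = inI a b j && (length (lowerCovers a j) ≡ᵇ 1)

  isM : C → C → C → Bool
  isM a b m = inI a b m && (length (upperCovers b m) ≡ᵇ 1)

  -- j_* (meaningful for join-irreducible j), m^* (for meet-irreducible m)
  lowerStar : C → C → C
  lowerStar a j with lowerCovers a j
  ... | y ∷ _ = y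
  ... | []    = j

  upperStar : C → C → C
  upperStar b m with upperCovers b m
  ... | y ∷ _ = y
  ... | []    = m

  inMaxJ : C → C → C → C → Bool
  inMaxJ a b j z =
    inI a b z && ((j ∧ z) == lowerStar a j)
    && not (anyF (λ w → inI a b w && (z <ᵇ w) && ((j ∧ w) == lowerStar a j)))

  inMinM : C → C → C → C → Bool
  inMinM a b m z =
    inI a b z && ((m ∨ z) == upperStar b m)
    && not (anyF (λ w → inI a b w && (w <ᵇ z) && ((m ∨ w) == upperStar b m)))

  -- κ is a pairing of [a , b] (its values off 𝓙 are irrelevant)
  record IsPairing (a b : C) (κ : C → C) : Set where
    field
      maps-to   : ∀ j → T (isJ a b j) → T (isM a b (κ j))
      injective : ∀ j j' → T (isJ a b j) → T (isJ a b j') → κ j ≡ κ j' → j ≡ j'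
      surjective : ∀ m → T (isM a b m) → ∃ λ j → T (isJ a b j) × κ j ≡ m
      κ∈𝓜       : ∀ j → T (isJ a b j) → T (inMaxJ a b j (κ j))
      κ⁻¹∈𝓙     : ∀ j → T (isJ a b j) → T (inMinM a b (κ j) j)

  UniquelyPaired : C → C → Set
  UniquelyPaired a b =
    Σ (C → C) λ κ → IsPairing a b κ ×
      (∀ κ' → IsPairing a b κ' → ∀ j → T (isJ a b j) → κ' j ≡ κ j)

  pairingOf : ∀ {a b} → UniquelyPaired a b → C → C
  pairingOf up = proj₁ up

  PrimePair : C → C → C → C → Set
  PrimePair a b j₀ m₀ =
    T (inI a b j₀) × T (inI a b m₀) ×
    (∀ x → T (inI a b x) → ((x ≤ m₀) ⊎ (j₀ ≤ x)) × ¬ ((x ≤ m₀) × (j₀ ≤ x)))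

  CondI : (a b : C) → (C → C) → (j₀ : C) → (C → C) → Set
  CondI a b κ j₀ κT =
    (∀ j → T (isJ a b j) → j₀ ≤ κ j →
       T (isJ j₀ b (j₀ ∨ j)) × κT (j₀ ∨ j) ≡ κ j) ×
    (∀ j j' → T (isJ a b j) → j₀ ≤ κ j → T (isJ a b j') → j₀ ≤ κ j' →
       (j₀ ∨ j) ≡ (j₀ ∨ j') → j ≡ j') ×
    (∀ j' → T (isJ j₀ b j') → ∃ λ j → T (isJ a b j) × j₀ ≤ κ j × (j₀ ∨ j) ≡ j')

  -- condition (ii): β(m) = m₀ ∧ m is a bijection
  -- {m ∈ 𝓜_[a,b] : κ⁻¹ m ≤ m₀} → 𝓜_[a,m₀] with κ_[a,m₀]⁻¹(β m) = κ⁻¹ m.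
  -- The domain is parametrised by j = κ⁻¹ m (κ is a bijection 𝓙 → 𝓜).
  CondII : (a b : C) → (C → C) → (m₀ : C) → (C → C) → Set
  CondII a b κ m₀ κB =
    (∀ j → T (isJ a b j) → j ≤ m₀ →
       T (isM a m₀ (m₀ ∧ κ j)) × T (isJ a m₀ j) × κB j ≡ (m₀ ∧ κ j)) ×
    (∀ j j' → T (isJ a b j) → j ≤ m₀ → T (isJ a b j') → j' ≤ m₀ →
       (m₀ ∧ κ j) ≡ (m₀ ∧ κ j') → κ j ≡ κ j') ×
    (∀ m' → T (isM a m₀ m') → ∃ λ j → T (isJ a b j) × j ≤ m₀ × (m₀ ∧ κ j) ≡ m')

  data CD (a b : C) : Set where
    trivial   : a ≡ b → UniquelyPaired a b → CD a b
    dismantle : (up : UniquelyPaired a b) (j₀ m₀ : C) → PrimePair a b j₀ m₀ →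
                (upT : UniquelyPaired j₀ b) → CD j₀ b →
                CondI a b (pairingOf up) j₀ (pairingOf upT) →
                (upB : UniquelyPaired a m₀) → CD a m₀ →
                CondII a b (pairingOf up) m₀ (pairingOf upB) →
                CD a b

  cdPaired : ∀ {a b} → CD a b → UniquelyPaired a b
  cdPaired (trivial _ up) = up
  cdPaired (dismantle up _ _ _ _ _ _ _ _ _) = up

  𝓙 : C → Bool
  𝓙 = isJ ⊥ ⊤

  module WithPairing (κ : C → C) where

    -- j ∈ 𝓓(x) iff j = j_{yx} for some y ⋖ x, where j_{yx} is the
    -- (unique) element of M_L(y) ∩ J_L(x)
    𝓓ᵇ : C → C → Bool
    𝓓ᵇ x j = 𝓙 j && anyF (λ y → (y ⋖ᵇ x) && (y ≤ᵇ κ j) && (j ≤ᵇ x))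

    𝓤ᵇ : C → C → Bool
    𝓤ᵇ x j = 𝓙 j && anyF (λ y → (x ⋖ᵇ y) && (x ≤ᵇ κ j) && (j ≤ᵇ y))

    𝓓 : C → Vec Bool n
    𝓓 x = tabulate (𝓓ᵇ x)

    𝓤 : C → Vec Bool n
    𝓤 x = tabulate (𝓤ᵇ x)

    arrow : C → C → Bool
    arrow j j' = 𝓙 j && 𝓙 j' && not (j == j') && not (j ≤ᵇ κ j')

    adj : C → C → Bool
    adj j j' = arrow j j' || arrow j' j

    vertexSet : Vec Bool n → Bool
    vertexSet S = allF (λ j → not (lookup S j) || 𝓙 j)

    independent : Vec Bool n → Bool
    independent S = vertexSet S &&
      allF (λ j → allF (λ j' → not (lookup S j && lookup S j' && adj j j')))

    dominating : Vec Bool n → Bool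
    dominating S = vertexSet S &&
      allF (λ v → not (𝓙 v) || lookup S v || anyF (λ u → lookup S u && adj u v))

    indDom : Vec Bool n → Bool
    indDom S = independent S && dominating S

    -- rowmotion: Row x is the element y with 𝓤(y) = 𝓓(x)
    -- (found by search; for semidistrim L such y exists and is unique)
    private
      search : C → List C → C
      search x []       = x
      search x (y ∷ ys) with VecP.≡-dec B._≟_ (𝓤 y) (𝓓 x)
      ... | yes _ = y
      ... | no  _ = search x ys

    Row : C → C
    Row x = search x elems

  Pop↓ : C → C
  Pop↓ x = foldr _∧_ x (filterᵇ (λ y → y ⋖ᵇ x) elems)

  Pop↑ : C → C
  Pop↑ x = foldr _∨_ x (filterᵇ (λ y → x ⋖ᵇ y) elems)

  #Pop↓ : ℕ
  #Pop↓ = countᵇ (λ y → anyF (λ x → Pop↓ x == y)) elems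

  #Pop↑ : ℕ
  #Pop↑ = countᵇ (λ y → anyF (λ x → Pop↑ x == y)) elems

record Semidistrim (L : FiniteLattice) : Set where
  open LatticeTheory L
  field
    cd : CD ⊥ ⊤
  κL : C → C
  κL = pairingOf (cdPaired cd)
  open WithPairing κL
  field
    𝓓-indep : ∀ x → T (independent (𝓓 x))
    𝓤-indep : ∀ x → T (independent (𝓤 x))

module SemidistrimTheory (L : FiniteLattice) (sd : Semidistrim L) where
  open LatticeTheory L public
  open Semidistrim sd using (κL) public
  open WithPairing κL public

  #RowLe : ℕ
  #RowLe = countᵇ (λ x → Row x ≤ᵇ x) elems

  #IndDom : ℕ
  #IndDom = countᵇ indDom (allSubsets n)

{-# OPTIONS --safe #-}
-- Every x is ⋁ 𝓓(x) and ⋀ κ(𝓤(x)): otherwise the label of a suitable cover gives a contradiction.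
-- Hence Row(x) = ⋀ κ(𝓓(x)) and Pop↓(x) = x ∧ Row(x). The key fact, by induction on the dismantling,
-- is that an independent set I of labels below v satisfies I ⊆ 𝓤(v ∧ ⋀ κ(I)). With v = ⊤ it
-- realises every independent set as some 𝓤(y); with v = x it gives 𝓓(x) ⊆ 𝓤(Pop↓ x), so if 𝓓(x) is
-- dominating then 𝓤(Pop↓ x) = 𝓓(x) = 𝓤(Row x) and Row(x) = Pop↓(x) ≤ x. Conversely, a vertex v
-- neither in nor adjacent to 𝓓(x) satisfies v ≤ Row(x) and x ≤ κ(v), so Row(x) ≰ x. Together with
-- the dual inclusion 𝓤(x) ⊆ 𝓓(Pop↑ x) this shows that the image of Pop↑ is {x : Row(x) ≤ x} and that
-- of Pop↓ is {Row(x) : Row(x) ≤ x}.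
module Submission where

open import Defs
open import Data.Bool using (Bool; true; false; T; not; T?)
import Data.Bool as Bool
open import Data.Bool.Properties using (T-∧; T-∨)
open import Data.Empty using (⊥-elim)
import Data.Fin as Fin
open import Data.Fin.Induction using (po-noetherian; Acc; acc)
import Data.Fin.Properties as FinP
open import Data.List using (List; []; _∷_; map; length; foldr; filter; filterᵇ; allFin)
open import Data.List.Membership.Propositional using (_∈_; lose)
open import Data.List.Membership.Propositional.Properties using
  (∈-allFin; ∈-filter⁺; ∈-filter⁻; ∈-map⁺; ∈-map⁻; ∈-++⁺ˡ; ∈-++⁺ʳ)
open import Data.List.Membership.Propositional.Properties.WithK using (unique∧set⇒bag)
open import Data.List.Properties using (length-map; filter-≐)
open import Data.List.Relation.Binary.BagAndSetEquality using (∼bag⇒↭)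
open import Data.List.Relation.Binary.Permutation.Propositional.Properties using (↭-length)
open import Data.List.Relation.Unary.All as All using ([]; _∷_; universal)
open import Data.List.Relation.Unary.All.Properties using (all⁺; all⁻)
open import Data.List.Relation.Unary.Any using (Any; here; there; satisfied)
open import Data.List.Relation.Unary.Any.Properties using (any⁺; any⁻)
open import Data.List.Relation.Unary.Unique.Propositional using (Unique; []; _∷_)
import Data.List.Relation.Unary.Unique.Propositional.Properties as Unique
open import Data.Nat using (ℕ; _≡ᵇ_)
open import Data.Product using (∃; _×_; _,_; proj₁; proj₂)
open import Data.Sum using (_⊎_; inj₁; inj₂; [_,_]′; swap)
open import Data.Vec as Vec using (Vec; lookup; tabulate)
import Data.Vec.Properties as VecP
open import Function using (_∘_; flip)
open import Function.Bundles using (_⇔_; mk⇔; Equivalence)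
import Relation.Binary.Construct.NonStrictToStrict as ToStrict
open import Relation.Binary.PropositionalEquality using (_≡_; _≢_; refl; sym; trans; cong; subst)
open import Relation.Binary.PropositionalEquality.Properties using (isEquivalence)
open import Relation.Binary.Structures using (IsPartialOrder)
open import Relation.Nullary using (¬_; Dec; yes; no)
open import Relation.Nullary.Decidable using
  (_→-dec_; _×-dec_; ¬?; decidable-stable; toWitness; fromWitness)

-- Order duality and order-theoretic preliminaries.

dual : FiniteLattice → FiniteLattice
dual L = record
  { n = n ; _≤ᵇ_ = flip _≤ᵇ_
  ; ≤-refl = ≤-refl
  ; ≤-antisym = λ x y p q → ≤-antisym x y q p
  ; ≤-trans = λ x y z p q → ≤-trans z y x q p
  ; _∧_ = _∨_ ; _∨_ = _∧_
  ; ∧-lb₁ = ∨-ub₁ ; ∧-lb₂ = ∨-ub₂ ; ∧-glb = ∨-lub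
  ; ∨-ub₁ = ∧-lb₁ ; ∨-ub₂ = ∧-lb₂ ; ∨-lub = ∧-glb
  ; ⊥ = ⊤ ; ⊤ = ⊥ ; ⊥-min = ⊤-max ; ⊤-max = ⊥-min
  }
  where open FiniteLattice L

module Order (L : FiniteLattice) where
  open LatticeTheory L using (_≤ᵇ_; ≤-refl; ≤-trans; ≤-antisym; ∧-lb₁; ∧-lb₂; ∧-glb; ∨-ub₁; ∨-ub₂; ∨-lub)
  open LatticeTheory L public using (C; _≤_; _∧_; _∨_; ⊥; ⊤)

  refl-≤ : ∀ {x} → x ≤ x
  refl-≤ {x} = ≤-refl x

  infixr 5 _⨾_
  _⨾_ : ∀ {x y z} → x ≤ y → y ≤ z → x ≤ z
  _⨾_ {x} {y} {z} = ≤-trans x y z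

  antisym : ∀ {x y} → x ≤ y → y ≤ x → x ≡ y
  antisym {x} {y} = ≤-antisym x y

  ≡⇒≤ : ∀ {x y} → x ≡ y → x ≤ y
  ≡⇒≤ refl = refl-≤

  _≤?_ : ∀ x y → Dec (x ≤ y)
  x ≤? y = T? (x ≤ᵇ y)

  ∧₁ : ∀ {x y} → (x ∧ y) ≤ x
  ∧₁ {x} {y} = ∧-lb₁ x y

  ∧₂ : ∀ {x y} → (x ∧ y) ≤ y
  ∧₂ {x} {y} = ∧-lb₂ x y

  glb : ∀ {x y z} → z ≤ x → z ≤ y → z ≤ (x ∧ y)
  glb {x} {y} {z} = ∧-glb x y z

  ∨₁ : ∀ {x y} → x ≤ (x ∨ y)
  ∨₁ {x} {y} = ∨-ub₁ x y

  ∨₂ : ∀ {x y} → y ≤ (x ∨ y)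
  ∨₂ {x} {y} = ∨-ub₂ x y

  lub : ∀ {x y z} → x ≤ z → y ≤ z → (x ∨ y) ≤ z
  lub {x} {y} {z} = ∨-lub x y z

  Cover : C → C → Set
  Cover x y = x ≤ y × ¬ (y ≤ x) × (∀ z → x ≤ z → z ≤ y → z ≤ x ⊎ y ≤ z)

  foldr-∧≤ : ∀ v xs → foldr _∧_ v xs ≤ v
  foldr-∧≤ v [] = refl-≤
  foldr-∧≤ v (x ∷ xs) = ∧₂ ⨾ foldr-∧≤ v xs

  foldr-∧≤∈ : ∀ v {x xs} → x ∈ xs → foldr _∧_ v xs ≤ x
  foldr-∧≤∈ v (here refl) = ∧₁
  foldr-∧≤∈ v (there x∈) = ∧₂ ⨾ foldr-∧≤∈ v x∈

  foldr-∧-greatest : ∀ v xs z → z ≤ v → (∀ x → x ∈ xs → z ≤ x) → z ≤ foldr _∧_ v xs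
  foldr-∧-greatest v [] z z≤v _ = z≤v
  foldr-∧-greatest v (x ∷ xs) z z≤v z≤ =
    glb (z≤ x (here refl)) (foldr-∧-greatest v xs z z≤v (λ y y∈ → z≤ y (there y∈)))

-- Labelled dismantlings of an interval.

-- A family of pairs lo j ≰ hi j indexed by labels j. In a compatibly dismantlable lattice the
-- labels are the join-irreducibles, lo j = j and hi j = κ(j); exchanging lo and hi gives the
-- same structure on the dual lattice.
module Labelled (L : FiniteLattice) (Label : LatticeTheory.C L → Set)
                (lo hi : LatticeTheory.C L → LatticeTheory.C L) where
  open Order L

  -- Compatible dismantlability of [a , b] with every interval labelled by the labels j of L such
  -- that lo j ≤ b and a ≤ hi j; such a j stands for the join-irreducible a ∨ lo j of [a , b],
  -- which is paired with b ∧ hi j.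
  data Dismantling (a b : C) : Set where
    point : a ≡ b → Dismantling a b
    split : (k : C) → Label k → lo k ≤ b → a ≤ hi k →
            (prime : ∀ x → a ≤ x → x ≤ b → x ≤ hi k ⊎ lo k ≤ x) →
            (exclusive : ∀ j → Label j → lo j ≤ b → a ≤ hi j →
                         ¬ (lo j ≤ hi k) → ¬ (lo k ≤ hi j) → j ≡ k) →
            Dismantling (a ∨ lo k) b → Dismantling a (b ∧ hi k) → Dismantling a b

  -- For `lo j = j` and `hi j = κ(j)` this is membership in `𝓤 x`. On the dual lattice, with `lo`
  -- and `hi` exchanged, it is membership in `𝓓 x`.
  Up : C → C → Set
  Up x j = Label j × x ≤ hi j × ∃ λ y → Cover x y × lo j ≤ y

  -- The absence of a Galois arrow from `i` to `j`. Independence quantifies over ordered pairs and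
  -- so excludes both directions.
  Compatible : C → C → Set
  Compatible i j = i ≢ j → lo i ≤ hi j

  Independent : (C → Set) → Set
  Independent I = ∀ i j → I i → I j → Compatible i j

  -- The element `v ∧ ⋀ hi(I)`, given by its universal property, so that the set `I` and the bound
  -- `v` can change in an induction while `x` stays fixed. On the dual lattice it is a join.
  record IsMeet (v : C) (I : C → Set) (x : C) : Set where
    field
      below    : x ≤ v
      below-hi : ∀ {i} → I i → x ≤ hi i
      greatest : ∀ z → z ≤ v → (∀ i → I i → z ≤ hi i) → z ≤ x

  meet-exists : (I : C → Set) → (∀ i → Dec (I i)) → ∀ v → ∃ (IsMeet v I)
  meet-exists I I? v = foldr _∧_ v his , record
    { below = foldr-∧≤ v his
    ; below-hi = λ Ii → foldr-∧≤∈ v (∈-map⁺ hi (∈-filter⁺ I? (∈-allFin _) Ii))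
    ; greatest = λ z z≤v z≤hi → foldr-∧-greatest v his z z≤v
        (λ y y∈ → let i , i∈ , y≡ = ∈-map⁻ hi y∈
                  in z≤hi i (proj₂ (∈-filter⁻ I? {xs = allFin _} i∈)) ⨾ ≡⇒≤ (sym y≡)) }
    where
    his : List C
    his = map hi (filter I? (allFin _))

-- Covers and independent sets in a labelled dismantling.

module Covers (L : FiniteLattice) (Label : LatticeTheory.C L → Set)
              (lo hi : LatticeTheory.C L → LatticeTheory.C L)
              (lo≰hi : ∀ j → Label j → ¬ LatticeTheory._≤_ L (lo j) (hi j)) where
  open Order L
  open Labelled L Label lo hi

  -- If `x` and `y` lie in the same part of the prime pair, induct there. Otherwise `x ≤ hi k` and
  -- `lo k ≤ y`: either `y ∧ hi k` is still not below `x` and the lower part supplies the cover, or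
  -- everything below both `y` and `hi k` is below `x`, and then `x ∨ lo k` covers `x` with label
  -- `k`.
  labelled-cover : ∀ {a b} → Dismantling a b → ∀ x y → a ≤ x → x ≤ y → y ≤ b → ¬ (y ≤ x) →
                   ∃ λ z → ∃ λ j → Cover x z × z ≤ y × Label j × lo j ≤ z × x ≤ hi j
  labelled-cover (point refl) x y a≤x x≤y y≤b y≰x = ⊥-elim (y≰x (y≤b ⨾ a≤x))
  labelled-cover (split k lk k≤b a≤k prime _ top bot) x y a≤x x≤y y≤b y≰x
    with prime y (a≤x ⨾ x≤y) y≤b | prime x a≤x (x≤y ⨾ y≤b)
  ... | inj₁ y≤hk | _ = labelled-cover bot x y a≤x x≤y (glb y≤b y≤hk) y≰x
  ... | inj₂ lk≤y | inj₂ lk≤x = labelled-cover top x y (lub a≤x lk≤x) x≤y y≤b y≰x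
  ... | inj₂ lk≤y | inj₁ x≤hk with (y ∧ hi k) ≤? x
  ...   | no ≰x =
          let z , j , c , z≤ , rest = labelled-cover bot x (y ∧ hi k) a≤x (glb x≤y x≤hk)
                                        (glb (∧₁ ⨾ y≤b) ∧₂) ≰x
          in z , j , c , z≤ ⨾ ∧₁ , rest
  ...   | yes ≤x = x ∨ lo k , k ,
          (∨₁ , (λ p → lo≰hi k lk (∨₂ ⨾ p ⨾ x≤hk)) , between) ,
          lub x≤y lk≤y , lk , ∨₂ , x≤hk
    where
    between : ∀ z → x ≤ z → z ≤ (x ∨ lo k) → z ≤ x ⊎ (x ∨ lo k) ≤ z
    between z x≤z z≤ with prime z (a≤x ⨾ x≤z) (z≤ ⨾ lub (x≤y ⨾ y≤b) k≤b)
    ... | inj₁ z≤hk = inj₁ (glb (z≤ ⨾ lub x≤y lk≤y) z≤hk ⨾ ≤x)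
    ... | inj₂ lk≤z = inj₂ (lub x≤z lk≤z)

  -- The independent set I of labels lives in [a , b] below v; the induction follows the part of the
  -- prime pair containing v, or, if some label of I does not belong to the upper part, replaces v
  -- by v ∧ hi k, which loses at most the label k, whose cover x ⋖ x ∨ lo k is explicit.
  independent⊆Up′ : ∀ {a b} → Dismantling a b → (I : C → Set) → (∀ i → Dec (I i)) →
    (∀ i → I i → Label i) → Independent I →
    ∀ v x → v ≤ b → a ≤ v → (∀ i → I i → lo i ≤ v) → (∀ i → I i → a ≤ hi i) →
    IsMeet v I x → ∀ t → I t → ∃ λ y → Cover x y × lo t ≤ y
  independent⊆Up′ (point refl) I I? lab ind v x v≤b a≤v lo≤v a≤hi m t It =
    ⊥-elim (lo≰hi t (lab t It) (lo≤v t It ⨾ v≤b ⨾ a≤hi t It))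
  independent⊆Up′ {a} {b} (split k lk k≤b a≤k prime excl top bot)
      I I? lab ind v x v≤b a≤v lo≤v a≤hi m t It
    with prime v a≤v v≤b
  ... | inj₁ v≤hk = independent⊆Up′ bot I I? lab ind v x (glb v≤b v≤hk) a≤v lo≤v a≤hi m t It
  ... | inj₂ k≤v with FinP.all? (λ i → I? i →-dec (lo k ≤? hi i))
  ...   | yes k≤hi = independent⊆Up′ top I I? lab ind v x v≤b (lub a≤v k≤v) lo≤v
                       (λ i Ii → lub (a≤hi i Ii) (k≤hi i Ii)) m t It
  ...   | no ¬all with FinP.¬∀⟶∃¬ _ _ (λ i → I? i →-dec (lo k ≤? hi i)) ¬all
  ...     | i₁ , ¬imp = conclude (t Fin.≟ k)
    where
    open IsMeet m
    Ii₁ : I i₁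
    Ii₁ = decidable-stable (I? i₁) (λ ¬I → ¬imp (⊥-elim ∘ ¬I))
    k≰i₁ : ¬ (lo k ≤ hi i₁)
    k≰i₁ p = ¬imp (λ _ → p)
    a≤x : a ≤ x
    a≤x = greatest a a≤v a≤hi
    -- If `x` were in the upper part, then `lo k ≤ x ≤ hi i₁`, against the choice of `i₁`.
    x≤hk : x ≤ hi k
    x≤hk with prime x a≤x (below ⨾ v≤b)
    ... | inj₁ p = p
    ... | inj₂ p = ⊥-elim (k≰i₁ (p ⨾ below-hi Ii₁))
    -- For `i = i₁`, exclusivity would force `i = k`. For any other `i` outside the lower part,
    -- primeness gives `lo k ≤ a ∨ lo i`, which is below `hi i₁` by independence, again against the
    -- choice of `i₁`.
    others≤hk : ∀ i → I i → i ≢ k → lo i ≤ hi k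
    others≤hk i Ii i≢k with lo i ≤? hi k
    ... | yes p = p
    ... | no i≰k with i Fin.≟ i₁
    ...   | yes refl = ⊥-elim (i≢k (excl i (lab i Ii) (lo≤v i Ii ⨾ v≤b) (a≤hi i Ii) i≰k k≰i₁))
    ...   | no i≢i₁ with prime (a ∨ lo i) ∨₁ (lub (a≤v ⨾ v≤b) (lo≤v i Ii ⨾ v≤b))
    ...     | inj₁ p = ∨₂ ⨾ p
    ...     | inj₂ p = ⊥-elim (k≰i₁ (p ⨾ lub (a≤hi i₁ Ii₁) (ind i i₁ Ii Ii₁ i≢i₁)))
    conclude : Dec (t ≡ k) → ∃ λ y → Cover x y × lo t ≤ y
    conclude (no t≢k) =
      independent⊆Up′ bot (λ i → I i × i ≢ k) I?′ (λ i → lab i ∘ proj₁)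
        (λ i j Ii Ij → ind i j (proj₁ Ii) (proj₁ Ij))
        (v ∧ hi k) x (glb (∧₁ ⨾ v≤b) ∧₂) (glb a≤v a≤k)
        (λ i Ii → glb (lo≤v i (proj₁ Ii)) (others≤hk i (proj₁ Ii) (proj₂ Ii)))
        (λ i → a≤hi i ∘ proj₁)
        (record { below = glb below x≤hk ; below-hi = below-hi ∘ proj₁ ; greatest = greatest′ })
        t (It , t≢k)
      where
      I?′ : ∀ i → Dec (I i × i ≢ k)
      I?′ i with I? i | i Fin.≟ k
      ... | no ¬I | _ = no (¬I ∘ proj₁)
      ... | yes _ | yes e = no (λ p → proj₂ p e)
      ... | yes Ii | no ≢k = yes (Ii , ≢k)
      -- Removing `k` from `I` leaves the meet unchanged, because the bound `hi k` has moved into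
      -- `v ∧ hi k`.
      greatest′ : ∀ z → z ≤ (v ∧ hi k) → (∀ i → I i × i ≢ k → z ≤ hi i) → z ≤ x
      greatest′ z z≤ z≤hi = greatest z (z≤ ⨾ ∧₁) z≤hi′
        where
        z≤hi′ : ∀ i → I i → z ≤ hi i
        z≤hi′ i Ii with i Fin.≟ k
        ... | yes refl = z≤ ⨾ ∧₂
        ... | no ≢k = z≤hi i (Ii , ≢k)
    conclude (yes refl) = x ∨ lo k , (∨₁ , (λ p → lo≰hi k lk (∨₂ ⨾ p ⨾ x≤hk)) , between) , ∨₂
      where
      between : ∀ z → x ≤ z → z ≤ (x ∨ lo k) → z ≤ x ⊎ (x ∨ lo k) ≤ z
      between z x≤z z≤ with prime z (a≤x ⨾ x≤z) (z≤ ⨾ lub (below ⨾ v≤b) k≤b)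
      ... | inj₂ k≤z = inj₂ (lub x≤z k≤z)
      ... | inj₁ z≤hk = inj₁ (greatest z (z≤ ⨾ lub below k≤v) z≤hi)
        where
        -- For `i ≢ k`, both `x` and `lo k` are below `hi i`, the latter by independence, hence so
        -- is `z ≤ x ∨ lo k`.
        z≤hi : ∀ i → I i → z ≤ hi i
        z≤hi i Ii with k Fin.≟ i
        ... | yes refl = z≤hk
        ... | no ≢i = z≤ ⨾ lub (below-hi Ii) (ind k i It Ii ≢i)

  module Whole (dis : Dismantling ⊥ ⊤) where
    open FiniteLattice L using (⊥-min; ⊤-max)

    -- If `z` is not below `x`, some cover of `x` inside `[x , x ∨ z]` has a label `j`; then
    -- `lo j ≤ x ∨ z ≤ hi j`, which is impossible. Thus `x` is the meet of `hi` over its upward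
    -- labels.
    greatest-below-Up : ∀ x z → (∀ j → Up x j → z ≤ hi j) → z ≤ x
    greatest-below-Up x z z≤hi with z ≤? x
    ... | yes p = p
    ... | no z≰x =
      let y , j , c , y≤ , lj , j≤y , x≤j =
            labelled-cover dis x (x ∨ z) (⊥-min _) ∨₁ (⊤-max _) (λ p → z≰x (∨₂ ⨾ p))
      in ⊥-elim (lo≰hi j lj (j≤y ⨾ y≤ ⨾ lub x≤j (z≤hi j (lj , x≤j , y , c , j≤y))))

    independent⊆Up : (I : C → Set) → (∀ i → Dec (I i)) → (∀ i → I i → Label i) →
      Independent I → ∀ v x → (∀ i → I i → lo i ≤ v) → IsMeet v I x → ∀ i → I i → Up x i
    independent⊆Up I I? lab ind v x lo≤v m i Ii =
      lab i Ii , IsMeet.below-hi m Ii ,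
      independent⊆Up′ dis I I? lab ind v x (⊤-max _) (⊥-min _) lo≤v (λ _ _ → ⊥-min _) m i Ii

    -- Since `I` already lies in `Up x`, a further label `j` of a cover `y` would be compatible with
    -- all of `I`. Then `y ≤ x ∨ lo j` is below every `hi i`, hence below the meet `x`, a
    -- contradiction.
    Up⊆independent : (I : C → Set) → (∀ i → Dec (I i)) → (∀ i → I i → Label i) →
      Independent I → ∀ x → IsMeet ⊤ I x → Independent (Up x) → ∀ j → Up x j → I j
    Up⊆independent I I? lab ind x m indUp j Uj@(lj , x≤j , y , (x≤y , y≰x , betw) , j≤y)
      with I? j
    ... | yes Ij = Ij
    ... | no ¬Ij = ⊥-elim (y≰x (IsMeet.greatest m y (⊤-max _) y≤hi))
      where
      y≤x∨j : y ≤ (x ∨ lo j)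
      y≤x∨j with betw (x ∨ lo j) ∨₁ (lub x≤y j≤y)
      ... | inj₁ p = ⊥-elim (lo≰hi j lj (∨₂ ⨾ p ⨾ x≤j))
      ... | inj₂ p = p
      y≤hi : ∀ i → I i → y ≤ hi i
      y≤hi i Ii = y≤x∨j ⨾ lub (IsMeet.below-hi m Ii)
        (indUp j i Uj (independent⊆Up I I? lab ind ⊤ x (λ _ _ → ⊤-max _) m i Ii)
          (λ j≡i → ¬Ij (subst I (sym j≡i) Ii)))

    realise : (I : C → Set) → (∀ i → Dec (I i)) → (∀ i → I i → Label i) → Independent I →
              (∀ x → Independent (Up x)) → ∃ λ x → ∀ j → Up x j ⇔ I j
    realise I I? lab ind indUp =
      let x , m = meet-exists I I? ⊤
      in x , λ j → mk⇔ (Up⊆independent I I? lab ind x m (indUp x) j)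
                       (independent⊆Up I I? lab ind ⊤ x (λ _ _ → ⊤-max _) m j)

    Down : C → C → Set
    Down x j = Label j × lo j ≤ x × ∃ λ y → Cover y x × y ≤ hi j

    -- A lower cover `y` of `x` with label `j` equals `x ∧ hi j`, so meeting with the lower covers
    -- amounts to meeting with the `hi j`. This describes `Pop↓`, and dually `Pop↑`, through labels.
    meet-of-lower-covers : ∀ x cs → (∀ y → y ∈ cs ⇔ Cover y x) → IsMeet x (Down x) (foldr _∧_ x cs)
    meet-of-lower-covers x cs cs-covers = record
      { below = foldr-∧≤ x cs
      ; below-hi = λ (_ , _ , y , c , y≤hj) → foldr-∧≤∈ x (Equivalence.from (cs-covers y) c) ⨾ y≤hj
      ; greatest = λ z z≤x z≤hi → foldr-∧-greatest x cs z z≤x (λ y y∈ → below-cover z z≤x z≤hi y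
                                                            (Equivalence.to (cs-covers y) y∈)) }
      where
      below-cover : ∀ z → z ≤ x → (∀ j → Down x j → z ≤ hi j) → ∀ y → Cover y x → z ≤ y
      below-cover z z≤x z≤hi y c@(y≤x , x≰y , betw)
        with labelled-cover dis y x (⊥-min _) y≤x (⊤-max _) x≰y
      ... | w , j , _ , w≤x , lj , j≤w , y≤hj with betw (x ∧ hi j) (glb y≤x y≤hj) ∧₁
      ...   | inj₁ p = glb z≤x (z≤hi j (lj , j≤w ⨾ w≤x , y , c , y≤hj)) ⨾ p
      ...   | inj₂ p = ⊥-elim (lo≰hi j lj (j≤w ⨾ w≤x ⨾ p ⨾ ∧₂))

-- Duality exchanges the two parts of every prime pair while keeping its label `k`, so each result
-- on `Up` has a free counterpart for downward labels.
dual-Dismantling : ∀ (L : FiniteLattice) Label lo hi {a b} → let open Labelled in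
  Dismantling L Label lo hi a b → Dismantling (dual L) Label hi lo b a
dual-Dismantling L Label lo hi (Labelled.point a≡b) = Labelled.point (sym a≡b)
dual-Dismantling L Label lo hi (Labelled.split k lk k≤b a≤k prime excl top bot) =
  Labelled.split k lk a≤k k≤b (λ x x≤b a≤x → swap (prime x a≤x x≤b))
    (λ j lj a≤j j≤b p q → excl j lj j≤b a≤j q p)
    (dual-Dismantling L Label lo hi bot) (dual-Dismantling L Label lo hi top)

-- Boolean tests reflected as order-theoretic statements.

∈-unique-singleton : {A : Set} {xs : List A} {x : A} → Unique xs → x ∈ xs →
                     (∀ {y} → y ∈ xs → y ≡ x) → xs ≡ x ∷ []
∈-unique-singleton {xs = y ∷ []} _ _ all≡ = cong (_∷ []) (all≡ (here refl))
∈-unique-singleton {xs = y ∷ z ∷ _} ((y≢z ∷ _) ∷ _) _ all≡ =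
  ⊥-elim (y≢z (trans (all≡ (here refl)) (sym (all≡ (there (here refl))))))

≡ᵇ1⇒singleton : {A : Set} (xs : List A) → T (length xs ≡ᵇ 1) → ∃ λ x → xs ≡ x ∷ []
≡ᵇ1⇒singleton (x ∷ []) _ = x , refl

T-not⁺ : ∀ {b} → ¬ T b → T (not b)
T-not⁺ {false} _ = _
T-not⁺ {true} ¬t = ¬t _

T-not⁻ : ∀ {b} → T (not b) → ¬ T b
T-not⁻ {false} _ ()

T-∧⁺ : ∀ {b c} → T b → T c → T (b Bool.∧ c)
T-∧⁺ p q = Equivalence.from T-∧ (p , q)

T-∧⁻ : ∀ {b c} → T (b Bool.∧ c) → T b × T c
T-∧⁻ = Equivalence.to T-∧

module Reflection (L : FiniteLattice) where
  open Order L
  open LatticeTheory L hiding (C; _≤_; _∧_; _∨_; ⊥; ⊤)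

  anyF⁺ : ∀ p x → T (p x) → T (anyF p)
  anyF⁺ p x px = any⁺ p (lose (∈-allFin x) px)

  anyF⁻ : ∀ p → T (anyF p) → ∃ λ x → T (p x)
  anyF⁻ p t = satisfied (any⁻ p elems t)

  allF⁺ : ∀ p → (∀ x → T (p x)) → T (allF p)
  allF⁺ p px = all⁻ p (universal px elems)

  allF⁻ : ∀ p → T (allF p) → ∀ x → T (p x)
  allF⁻ p t x = All.lookup (all⁺ p elems t) (∈-allFin x)

  ==⁺ : ∀ {x y} → x ≡ y → T (x == y)
  ==⁺ = fromWitness

  ==⁻ : ∀ {x y} → T (x == y) → x ≡ y
  ==⁻ = toWitness

  <⁺ : ∀ {x y} → x ≤ y → ¬ (y ≤ x) → T (x <ᵇ y)
  <⁺ x≤y y≰x = T-∧⁺ x≤y (T-not⁺ (λ e → y≰x (≡⇒≤ (sym (==⁻ e)))))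

  <⁻ : ∀ {x y} → T (x <ᵇ y) → x ≤ y × ¬ (y ≤ x)
  <⁻ t = let x≤y , x≢y = T-∧⁻ t in
         x≤y , λ y≤x → T-not⁻ x≢y (==⁺ (antisym x≤y y≤x))

  ⋖⁺ : ∀ {x y} → Cover x y → T (x ⋖ᵇ y)
  ⋖⁺ {x} {y} (x≤y , y≰x , betw) = T-∧⁺ (<⁺ x≤y y≰x) (T-not⁺ strict)
    where
    strict : ¬ T (anyF (λ z → (x <ᵇ z) Bool.∧ (z <ᵇ y)))
    strict t with anyF⁻ _ t
    ... | z , p with T-∧⁻ p
    ... | x<z , z<y with <⁻ {x} {z} x<z | <⁻ {z} {y} z<y
    ... | x≤z , z≰x | z≤y , y≰z with betw z x≤z z≤y
    ... | inj₁ z≤x = z≰x z≤x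
    ... | inj₂ y≤z = y≰z y≤z

  ⋖⁻ : ∀ {x y} → T (x ⋖ᵇ y) → Cover x y
  ⋖⁻ {x} {y} t = let x<y , none = T-∧⁻ t ; x≤y , y≰x = <⁻ {x} {y} x<y in x≤y , y≰x , between none
    where
    between : T (not (anyF (λ z → (x <ᵇ z) Bool.∧ (z <ᵇ y)))) →
              ∀ z → x ≤ z → z ≤ y → z ≤ x ⊎ y ≤ z
    between none z x≤z z≤y with z ≤? x | y ≤? z
    ... | yes p | _ = inj₁ p
    ... | no _ | yes q = inj₂ q
    ... | no ¬p | no ¬q = ⊥-elim (T-not⁻ none (anyF⁺ _ z (T-∧⁺ (<⁺ x≤z ¬p) (<⁺ z≤y ¬q))))

  inI⁻ : ∀ {a b x} → T (inI a b x) → a ≤ x × x ≤ b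
  inI⁻ = T-∧⁻

  ∈lowerCovers⁺ : ∀ {a j c} → a ≤ c → Cover c j → c ∈ lowerCovers a j
  ∈lowerCovers⁺ a≤c c⋖j = ∈-filter⁺ (T? ∘ _) (∈-allFin _) (T-∧⁺ a≤c (⋖⁺ c⋖j))

  ∈lowerCovers⁻ : ∀ {a j c} → c ∈ lowerCovers a j → a ≤ c × Cover c j
  ∈lowerCovers⁻ {a} {j} {c} c∈ =
    let a≤c , c⋖j = T-∧⁻ (proj₂ (∈-filter⁻ (λ y → T? ((a ≤ᵇ y) Bool.∧ (y ⋖ᵇ j))) {xs = elems} c∈))
    in a≤c , ⋖⁻ c⋖j

  lowerStar-∷ : ∀ {a j s ss} → lowerCovers a j ≡ s ∷ ss → lowerStar a j ≡ s
  lowerStar-∷ {a} {j} eq with lowerCovers a j | eq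
  ... | _ ∷ _ | refl = refl

  isJ⁻ : ∀ {a b j} → T (isJ a b j) → (a ≤ j × j ≤ b) × a ≤ lowerStar a j ×
         Cover (lowerStar a j) j × (∀ c → a ≤ c → Cover c j → c ≡ lowerStar a j)
  isJ⁻ {a} {b} {j} t with T-∧⁻ t
  ... | tI , t1 with ≡ᵇ1⇒singleton _ t1
  ... | s , eq rewrite lowerStar-∷ {a} {j} eq =
    let a≤s , s⋖j = ∈lowerCovers⁻ {a} {j} (subst (s ∈_) (sym eq) (here refl))
    in inI⁻ {a} {b} {j} tI , a≤s , s⋖j , only
    where
    only : ∀ c → a ≤ c → Cover c j → c ≡ s
    only c a≤c c⋖j with subst (c ∈_) eq (∈lowerCovers⁺ a≤c c⋖j)
    ... | here e = e

  isJ⁺ : ∀ {a b j s} → a ≤ j → j ≤ b → a ≤ s → Cover s j →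
         (∀ c → a ≤ c → Cover c j → c ≡ s) → T (isJ a b j)
  isJ⁺ {a} {b} {j} {s} a≤j j≤b a≤s s⋖j only =
    T-∧⁺ (T-∧⁺ a≤j j≤b) (subst (λ xs → T (length xs ≡ᵇ 1)) (sym eq) _)
    where
    eq : lowerCovers a j ≡ s ∷ []
    eq = ∈-unique-singleton (Unique.filter⁺ (T? ∘ _) (Unique.allFin⁺ _)) (∈lowerCovers⁺ a≤s s⋖j)
           (λ c∈ → let a≤c , c⋖j = ∈lowerCovers⁻ {a} {j} c∈ in only _ a≤c c⋖j)

  ≤-isPartialOrder : IsPartialOrder _≡_ _≤_
  ≤-isPartialOrder = record
    { isPreorder = record { isEquivalence = isEquivalence ; reflexive = ≡⇒≤ ; trans = _⨾_ }
    ; antisym = antisym }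

  -- Climbing from `x` through elements strictly between ends by finiteness.
  coatom-above : ∀ x y → x ≤ y → ¬ (y ≤ x) → ∃ λ c → x ≤ c × Cover c y
  coatom-above x y = go x (po-noetherian ≤-isPartialOrder x)
    where
    go : ∀ x → Acc (flip (ToStrict._<_ _≡_ _≤_)) x → x ≤ y → ¬ (y ≤ x) → ∃ λ c → x ≤ c × Cover c y
    go x (acc rec) x≤y y≰x
      with FinP.any? (λ z → (x ≤? z ×-dec z ≤? y) ×-dec (¬? (z ≤? x) ×-dec ¬? (y ≤? z)))
    ... | yes (z , (x≤z , z≤y) , z≰x , y≰z) =
      let c , z≤c , c⋖y = go z (rec (x≤z , λ x≡z → z≰x (≡⇒≤ (sym x≡z)))) z≤y y≰z in c , x≤z ⨾ z≤c , c⋖y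
    ... | no none = x , refl-≤ , x≤y , y≰x , between
      where
      between : ∀ z → x ≤ z → z ≤ y → z ≤ x ⊎ y ≤ z
      between z x≤z z≤y with z ≤? x | y ≤? z
      ... | yes p | _ = inj₁ p
      ... | no _ | yes q = inj₂ q
      ... | no ¬p | no ¬q = ⊥-elim (none (z , (x≤z , z≤y) , ¬p , ¬q))

  -- Pairings and prime pairs.

  module Pairing {a b κ} (π : IsPairing a b κ) where
    open IsPairing π

    κ-interval : ∀ {j} → T (isJ a b j) → a ≤ κ j × κ j ≤ b
    κ-interval {j} J = inI⁻ {a} {b} {κ j} (proj₁ (T-∧⁻ (κ∈𝓜 j J)))

    j∧κj : ∀ {j} → T (isJ a b j) → (j ∧ κ j) ≡ lowerStar a j
    j∧κj {j} J = ==⁻ (proj₁ (T-∧⁻ (proj₂ (T-∧⁻ {inI a b (κ j)} (κ∈𝓜 j J)))))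

    j≰κj : ∀ {j} → T (isJ a b j) → ¬ (j ≤ κ j)
    j≰κj {j} J j≤κj =
      let _ , _ , (_ , j≰s , _) , _ = isJ⁻ {a} {b} {j} J
      in j≰s (glb refl-≤ j≤κj ⨾ ≡⇒≤ (j∧κj J))

    κ-maximal : ∀ {j} → T (isJ a b j) → ∀ w → a ≤ w → w ≤ b → κ j ≤ w →
                (j ∧ w) ≡ lowerStar a j → w ≤ κ j
    κ-maximal {j} J w a≤w w≤b κ≤w eq with w ≤? κ j
    ... | yes p = p
    ... | no ¬p = ⊥-elim (T-not⁻
                    (proj₂ (T-∧⁻ {(j ∧ κ j) == lowerStar a j} (proj₂ (T-∧⁻ {inI a b (κ j)} (κ∈𝓜 j J)))))
                    (anyF⁺ _ w (T-∧⁺ {inI a b w} (T-∧⁺ a≤w w≤b) (T-∧⁺ (<⁺ κ≤w ¬p) (==⁺ eq)))))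

  module Prime {a b j₀ m₀} (pp : PrimePair a b j₀ m₀) where
    a≤j₀ : a ≤ j₀
    a≤j₀ = proj₁ (inI⁻ {a} {b} {j₀} (proj₁ pp))
    j₀≤b : j₀ ≤ b
    j₀≤b = proj₂ (inI⁻ {a} {b} {j₀} (proj₁ pp))
    a≤m₀ : a ≤ m₀
    a≤m₀ = proj₁ (inI⁻ {a} {b} {m₀} (proj₁ (proj₂ pp)))
    m₀≤b : m₀ ≤ b
    m₀≤b = proj₂ (inI⁻ {a} {b} {m₀} (proj₁ (proj₂ pp)))

    prime : ∀ x → a ≤ x → x ≤ b → x ≤ m₀ ⊎ j₀ ≤ x
    prime x a≤x x≤b = proj₁ (proj₂ (proj₂ pp) x (T-∧⁺ a≤x x≤b))

    j₀≰m₀ : ¬ (j₀ ≤ m₀)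
    j₀≰m₀ p = proj₂ (proj₂ (proj₂ pp) j₀ (proj₁ pp)) (p , refl-≤)

    j₀∧m₀⋖j₀ : Cover (j₀ ∧ m₀) j₀
    j₀∧m₀⋖j₀ = ∧₁ , (λ p → j₀≰m₀ (p ⨾ ∧₂)) , between
      where
      between : ∀ z → (j₀ ∧ m₀) ≤ z → z ≤ j₀ → z ≤ (j₀ ∧ m₀) ⊎ j₀ ≤ z
      between z ≤z z≤ with prime z (glb a≤j₀ a≤m₀ ⨾ ≤z) (z≤ ⨾ j₀≤b)
      ... | inj₁ z≤m₀ = inj₁ (glb z≤ z≤m₀)
      ... | inj₂ j₀≤z = inj₂ j₀≤z

    -- By primeness every lower cover of `j₀` is below `m₀`, hence below `j₀ ∧ m₀`, which is itself
    -- covered by `j₀`.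
    j₀-isJ : T (isJ a b j₀)
    j₀-isJ = isJ⁺ a≤j₀ j₀≤b (glb a≤j₀ a≤m₀) j₀∧m₀⋖j₀ only
      where
      only : ∀ c → a ≤ c → Cover c j₀ → c ≡ (j₀ ∧ m₀)
      only c a≤c (c≤j₀ , j₀≰c , betw) with prime c a≤c (c≤j₀ ⨾ j₀≤b)
      ... | inj₂ j₀≤c = ⊥-elim (j₀≰c j₀≤c)
      ... | inj₁ c≤m₀ with betw (j₀ ∧ m₀) (glb c≤j₀ c≤m₀) ∧₁
      ...   | inj₁ p = antisym (glb c≤j₀ c≤m₀) p
      ...   | inj₂ p = ⊥-elim (j₀≰m₀ (p ⨾ ∧₂))

    module _ {κ} (π : IsPairing a b κ) where
      open Pairing π

      -- Not being above `j₀`, the element `κ j₀` is below `m₀`. As `j₀ ∧ m₀` is the lower cover of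
      -- `j₀`, maximality of `κ j₀` gives equality.
      κj₀≡m₀ : κ j₀ ≡ m₀
      κj₀≡m₀ with prime (κ j₀) (proj₁ (κ-interval j₀-isJ)) (proj₂ (κ-interval j₀-isJ))
      ... | inj₂ p = ⊥-elim (j≰κj j₀-isJ p)
      ... | inj₁ p = antisym p (κ-maximal j₀-isJ m₀ a≤m₀ m₀≤b p
                       (proj₂ (proj₂ (proj₂ (isJ⁻ {a} {b} j₀-isJ))) _ (glb a≤j₀ a≤m₀) j₀∧m₀⋖j₀))

      -- Any other join-irreducible above j₀ still has j₀ below its lower cover j ∧ κ j.
      j≡j₀ : ∀ j → T (isJ a b j) → ¬ (j ≤ m₀) → ¬ (j₀ ≤ κ j) → j ≡ j₀
      j≡j₀ j J j≰m₀ j₀≰κj with isJ⁻ {a} {b} {j} J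
      ... | (a≤j , j≤b) , _ , _ , only with prime j a≤j j≤b
      ... | inj₁ p = ⊥-elim (j≰m₀ p)
      ... | inj₂ j₀≤j with j ≤? j₀
      ... | yes j≤j₀ = antisym j≤j₀ j₀≤j
      ... | no j≰j₀ with coatom-above j₀ j j₀≤j j≰j₀
      ... | c , j₀≤c , c⋖j =
        ⊥-elim (j₀≰κj (j₀≤c ⨾ ≡⇒≤ (trans (only c (a≤j₀ ⨾ j₀≤c) c⋖j) (sym (j∧κj J))) ⨾ ∧₂))

  -- From compatible dismantlability to a labelled dismantling.

  module FromCD (κ : C → C) where
    open Labelled L (T ∘ 𝓙) (λ j → j) κ

    -- The invariant of the recursion: it ties the pairing of each interval to the single pairing
    -- `κ` of the whole lattice.
    record Represents (a b : C) (κ′ : C → C) : Set where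
      field
        to   : ∀ j → T (𝓙 j) → j ≤ b → a ≤ κ j → T (isJ a b (a ∨ j)) × κ′ (a ∨ j) ≡ (b ∧ κ j)
        onto : ∀ j′ → T (isJ a b j′) → ∃ λ j → T (𝓙 j) × j ≤ b × a ≤ κ j × (a ∨ j) ≡ j′
        inj  : ∀ i j → T (𝓙 i) → i ≤ b → a ≤ κ i → T (𝓙 j) → j ≤ b → a ≤ κ j →
               (a ∨ i) ≡ (a ∨ j) → i ≡ j

    -- The element `j₀` is join-irreducible in `[a , b]`, hence `a ∨ k` for a label `k`, and `m₀` is
    -- its partner `b ∧ κ k`. Conditions (i) and (ii) carry the invariant to the upper and the lower
    -- part.
    dismantling : ∀ {a b} (cd : CD a b) → Represents a b (pairingOf (cdPaired cd)) → Dismantling a b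
    dismantling (trivial a≡b _) _ = point a≡b
    dismantling {a} {b}
        (dismantle up j₀ m₀ pp upT cdT (Tto , Tinj , Tonto) upB cdB (Bto , _ , _)) R
      with Represents.onto R j₀ (Prime.j₀-isJ pp)
    ... | k , Jk , k≤b , a≤k , refl =
      split k Jk k≤b a≤k prime′ exclusive′ (dismantling cdT RT)
        (subst (Dismantling a) m₀≡ (dismantling cdB RB))
      where
      open Represents R
      open Prime pp
      κab : C → C
      κab = pairingOf up
      π : IsPairing a b κab
      π = proj₁ (proj₂ up)
      m₀≡ : m₀ ≡ (b ∧ κ k)
      m₀≡ = trans (sym (κj₀≡m₀ π)) (proj₂ (to k Jk k≤b a≤k))
      prime′ : ∀ x → a ≤ x → x ≤ b → x ≤ κ k ⊎ k ≤ x
      prime′ x a≤x x≤b with prime x a≤x x≤b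
      ... | inj₁ p = inj₁ (p ⨾ ≡⇒≤ m₀≡ ⨾ ∧₂)
      ... | inj₂ p = inj₂ (∨₂ ⨾ p)
      exclusive′ : ∀ j → T (𝓙 j) → j ≤ b → a ≤ κ j → ¬ (j ≤ κ k) → ¬ (k ≤ κ j) → j ≡ k
      exclusive′ j Jj j≤b a≤j j≰ k≰ = inj j k Jj j≤b a≤j Jk k≤b a≤k
        (j≡j₀ π (a ∨ j) (proj₁ (to j Jj j≤b a≤j)) (λ p → j≰ (∨₂ ⨾ p ⨾ ≡⇒≤ m₀≡ ⨾ ∧₂))
          (λ p → k≰ (∨₂ ⨾ p ⨾ ≡⇒≤ (proj₂ (to j Jj j≤b a≤j)) ⨾ ∧₂)))

      -- `CD` holds the pairing of each part twice, once beside the conditions and once inside the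
      -- recursive witness; uniqueness identifies the two.
      agree : ∀ {c d} (u u′ : UniquelyPaired c d) → ∀ j → T (isJ c d j) → pairingOf u′ j ≡ pairingOf u j
      agree u u′ = proj₂ (proj₂ u) (pairingOf u′) (proj₁ (proj₂ u′))

      j₀∨a∨ : ∀ j → ((a ∨ k) ∨ (a ∨ j)) ≡ ((a ∨ k) ∨ j)
      j₀∨a∨ j = antisym (lub ∨₁ (lub (∨₁ ⨾ ∨₁) ∨₂)) (lub ∨₁ (∨₂ ⨾ ∨₂))

      RT : Represents (a ∨ k) b (pairingOf (cdPaired cdT))
      RT = record { to = toT ; onto = ontoT ; inj = injT }
        where
        j₀≤κab : ∀ j → T (𝓙 j) → j ≤ b → (a ∨ k) ≤ κ j → (a ∨ k) ≤ κab (a ∨ j)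
        j₀≤κab j Jj j≤b ≤κj = glb j₀≤b ≤κj ⨾ ≡⇒≤ (sym (proj₂ (to j Jj j≤b (∨₁ ⨾ ≤κj))))
        toT : ∀ j → T (𝓙 j) → j ≤ b → (a ∨ k) ≤ κ j →
              T (isJ (a ∨ k) b ((a ∨ k) ∨ j)) × pairingOf (cdPaired cdT) ((a ∨ k) ∨ j) ≡ (b ∧ κ j)
        toT j Jj j≤b ≤κj =
          let J , eq = to j Jj j≤b (∨₁ ⨾ ≤κj)
              JT , eqT = Tto (a ∨ j) J (j₀≤κab j Jj j≤b ≤κj)
              JT′ = subst (T ∘ isJ (a ∨ k) b) (j₀∨a∨ j) JT
          in JT′ , trans (agree upT (cdPaired cdT) _ JT′)
                     (trans (cong (pairingOf upT) (sym (j₀∨a∨ j))) (trans eqT eq))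
        ontoT : ∀ j′ → T (isJ (a ∨ k) b j′) →
                ∃ λ j → T (𝓙 j) × j ≤ b × (a ∨ k) ≤ κ j × ((a ∨ k) ∨ j) ≡ j′
        ontoT j′ J′ with Tonto j′ J′
        ... | i , Ji , j₀≤κi , eq with onto i Ji
        ... | j , Jj , j≤b , a≤j , refl =
          j , Jj , j≤b , j₀≤κi ⨾ ≡⇒≤ (proj₂ (to j Jj j≤b a≤j)) ⨾ ∧₂ , trans (sym (j₀∨a∨ j)) eq
        injT : ∀ i j → T (𝓙 i) → i ≤ b → (a ∨ k) ≤ κ i → T (𝓙 j) → j ≤ b → (a ∨ k) ≤ κ j →
               ((a ∨ k) ∨ i) ≡ ((a ∨ k) ∨ j) → i ≡ j
        injT i j Ji i≤b ≤κi Jj j≤b ≤κj eq =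
          inj i j Ji i≤b (∨₁ ⨾ ≤κi) Jj j≤b (∨₁ ⨾ ≤κj)
            (Tinj _ _ (proj₁ (to i Ji i≤b (∨₁ ⨾ ≤κi))) (j₀≤κab i Ji i≤b ≤κi)
              (proj₁ (to j Jj j≤b (∨₁ ⨾ ≤κj))) (j₀≤κab j Jj j≤b ≤κj)
              (trans (j₀∨a∨ i) (trans eq (sym (j₀∨a∨ j)))))

      RB : Represents a m₀ (pairingOf (cdPaired cdB))
      RB = record { to = toB ; onto = ontoB ; inj = injB }
        where
        toB : ∀ j → T (𝓙 j) → j ≤ m₀ → a ≤ κ j →
              T (isJ a m₀ (a ∨ j)) × pairingOf (cdPaired cdB) (a ∨ j) ≡ (m₀ ∧ κ j)
        toB j Jj j≤m₀ a≤j =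
          let J , eq = to j Jj (j≤m₀ ⨾ m₀≤b) a≤j
              _ , JB , eqB = Bto (a ∨ j) J (lub a≤m₀ j≤m₀)
          in JB , trans (agree upB (cdPaired cdB) _ JB) (trans eqB (trans (cong (m₀ ∧_) eq)
               (antisym (glb ∧₁ (∧₂ ⨾ ∧₂)) (glb ∧₁ (glb (∧₁ ⨾ m₀≤b) ∧₂)))))
        ontoB : ∀ j′ → T (isJ a m₀ j′) → ∃ λ j → T (𝓙 j) × j ≤ m₀ × a ≤ κ j × (a ∨ j) ≡ j′
        ontoB j′ J′ with T-∧⁻ {inI a m₀ j′} J′
        ... | tI , t1 with inI⁻ {a} {m₀} {j′} tI
        -- Lower covers in an interval depend only on its bottom, so `j′` is also join-irreducible
        -- in `[a , b]`.
        ... | a≤j′ , j′≤m₀ with onto j′ (T-∧⁺ {inI a b j′} (T-∧⁺ a≤j′ (j′≤m₀ ⨾ m₀≤b)) t1)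
        ... | j , Jj , _ , a≤j , refl = j , Jj , ∨₂ ⨾ j′≤m₀ , a≤j , refl
        injB : ∀ i j → T (𝓙 i) → i ≤ m₀ → a ≤ κ i → T (𝓙 j) → j ≤ m₀ → a ≤ κ j →
               (a ∨ i) ≡ (a ∨ j) → i ≡ j
        injB i j Ji i≤ a≤i Jj j≤ a≤j = inj i j Ji (i≤ ⨾ m₀≤b) a≤i Jj (j≤ ⨾ m₀≤b) a≤j

  whole-dismantling : (cd : CD ⊥ ⊤) → let κ = pairingOf (cdPaired cd) in
                      Labelled.Dismantling L (T ∘ 𝓙) (λ j → j) κ ⊥ ⊤
  whole-dismantling cd = FromCD.dismantling κ cd (record
    { to = λ j Jj _ _ → subst (T ∘ 𝓙) (sym (⊥∨ j)) Jj ,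
                        trans (cong κ (⊥∨ j)) (antisym (glb (⊤-max _) refl-≤) ∧₂)
    ; onto = λ j Jj → j , Jj , ⊤-max _ , ⊥-min _ , ⊥∨ j
    ; inj = λ i j _ _ _ _ _ _ eq → trans (sym (⊥∨ i)) (trans eq (⊥∨ j)) })
    where
    κ : C → C
    κ = pairingOf (cdPaired cd)
    ⊥∨ : ∀ j → (⊥ ∨ j) ≡ j
    ⊥∨ j = antisym (lub (⊥-min _) refl-≤) ∨₂

-- Counting and enumeration of subsets.

countᵇ-cong : {A : Set} {p q : A → Bool} → (∀ x → T (p x) ⇔ T (q x)) →
              ∀ xs → countᵇ p xs ≡ countᵇ q xs
countᵇ-cong {p = p} {q} p⇔q xs = cong length (filter-≐ (T? ∘ p) (T? ∘ q)
  ((λ {x} → Equivalence.to (p⇔q x)) , (λ {x} → Equivalence.from (p⇔q x))) xs)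

-- Duplicate-free lists with the same members are permutations of each other and so have equal
-- length.
countᵇ-bijection : {A B : Set} {p : A → Bool} {q : B → Bool} {xs : List A} {ys : List B} (f : A → B) →
  Unique xs → Unique ys → (∀ x → x ∈ xs) → (∀ y → y ∈ ys) →
  (∀ x → T (p x) → T (q (f x))) →
  (∀ x x′ → f x ≡ f x′ → x ≡ x′) →
  (∀ y → T (q y) → ∃ λ x → T (p x) × f x ≡ y) →
  countᵇ p xs ≡ countᵇ q ys
countᵇ-bijection {p = p} {q} {xs} {ys} f uxs uys allx ally to inj onto =
  trans (sym (length-map f (filterᵇ p xs)))
    (↭-length (∼bag⇒↭ (unique∧set⇒bag (Unique.map⁺ (inj _ _) (Unique.filter⁺ (T? ∘ p) uxs))
      (Unique.filter⁺ (T? ∘ q) uys) (mk⇔ there⁺ back))))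
  where
  there⁺ : ∀ {y} → y ∈ map f (filterᵇ p xs) → y ∈ filterᵇ q ys
  there⁺ y∈ with ∈-map⁻ f y∈
  ... | x , x∈ , refl = ∈-filter⁺ (T? ∘ q) (ally _) (to x (proj₂ (∈-filter⁻ (T? ∘ p) {xs = xs} x∈)))
  back : ∀ {y} → y ∈ filterᵇ q ys → y ∈ map f (filterᵇ p xs)
  back y∈ with onto _ (proj₂ (∈-filter⁻ (T? ∘ q) {xs = ys} y∈))
  ... | x , px , refl = ∈-map⁺ f (∈-filter⁺ (T? ∘ p) (allx x) px)

∈-allSubsets : ∀ {n} (S : Vec Bool n) → S ∈ allSubsets n
∈-allSubsets Vec.[] = here refl
∈-allSubsets (true Vec.∷ S) = ∈-++⁺ˡ (∈-map⁺ _ (∈-allSubsets S))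
∈-allSubsets {ℕ.suc n} (false Vec.∷ S) = ∈-++⁺ʳ (map (true Vec.∷_) (allSubsets n)) (∈-map⁺ _ (∈-allSubsets S))

allSubsets-unique : ∀ n → Unique (allSubsets n)
allSubsets-unique ℕ.zero = [] ∷ []
allSubsets-unique (ℕ.suc n) =
  Unique.++⁺ (Unique.map⁺ VecP.∷-injectiveʳ u) (Unique.map⁺ VecP.∷-injectiveʳ u) disjoint
  where
  u : Unique (allSubsets n)
  u = allSubsets-unique n
  disjoint : ∀ {S} → ¬ (S ∈ map (true Vec.∷_) (allSubsets n) × S ∈ map (false Vec.∷_) (allSubsets n))
  disjoint (p , q) with ∈-map⁻ _ p | ∈-map⁻ _ q
  ... | _ , _ , refl | _ , _ , ()

-- Rowmotion and the Pop operators.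

module RowSearch (L : FiniteLattice) (κ : LatticeTheory.C L → LatticeTheory.C L) where
  open LatticeTheory L
  open WithPairing κ

  -- The search inside Row is private to Defs. The underscore is solved by unification in the next
  -- lemma, where the list being searched is abstracted to a variable.
  mutual
    search : C → List C → C
    search = _

    search-elems : ∀ x → search x elems ≡ Row x
    search-elems x with elems
    ... | _ = refl

  search-finds : ∀ x ys → Any (λ y → 𝓤 y ≡ 𝓓 x) ys → 𝓤 (search x ys) ≡ 𝓓 x
  search-finds x (y ∷ ys) found with VecP.≡-dec Bool._≟_ (𝓤 y) (𝓓 x) | found
  ... | yes e | _ = e
  ... | no ¬e | here e = ⊥-elim (¬e e)
  ... | no _ | there rest = search-finds x ys rest

module Rowmotion
  (L : FiniteLattice) (κ : LatticeTheory.C L → LatticeTheory.C L)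
  (j≰κj : ∀ j → T (LatticeTheory.𝓙 L j) → ¬ LatticeTheory._≤_ L j (κ j))
  (dismantling : Labelled.Dismantling L (T ∘ LatticeTheory.𝓙 L) (λ j → j) κ
                   (FiniteLattice.⊥ L) (FiniteLattice.⊤ L))
  (𝓓-indep : ∀ x → T (LatticeTheory.WithPairing.independent L κ (LatticeTheory.WithPairing.𝓓 L κ x)))
  (𝓤-indep : ∀ x → T (LatticeTheory.WithPairing.independent L κ (LatticeTheory.WithPairing.𝓤 L κ x)))
  where

  open LatticeTheory L hiding (C; _≤_; _∧_; _∨_; ⊥; ⊤; ≤-refl; ≤-antisym; ≤-trans)
  open WithPairing κ
  open Order L
  open Reflection L
  open RowSearch L κ

  module ↑ = Labelled L (T ∘ 𝓙) (λ j → j) κ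
  module ↓ = Labelled (dual L) (T ∘ 𝓙) κ (λ j → j)
  module Whole↑ = Covers.Whole L (T ∘ 𝓙) (λ j → j) κ j≰κj dismantling
  module Whole↓ = Covers.Whole (dual L) (T ∘ 𝓙) κ (λ j → j) j≰κj
                    (dual-Dismantling L (T ∘ 𝓙) (λ j → j) κ dismantling)

  Cover-dual : ∀ {x y} → Cover y x → Order.Cover (dual L) x y
  Cover-dual (y≤x , x≰y , betw) = y≤x , x≰y , λ z z≤x y≤z → swap (betw z y≤z z≤x)

  Cover-dual⁻ : ∀ {x y} → Order.Cover (dual L) x y → Cover y x
  Cover-dual⁻ (y≤x , x≰y , betw) = y≤x , x≰y , λ z y≤z z≤x → swap (betw z z≤x y≤z)

  ∈𝓤 ∈𝓓 : C → C → Set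
  ∈𝓤 x j = T (𝓤ᵇ x j)
  ∈𝓓 x j = T (𝓓ᵇ x j)

  𝓤⇒Up : ∀ {x j} → ∈𝓤 x j → ↑.Up x j
  𝓤⇒Up {x} {j} t with T-∧⁻ {𝓙 j} t
  ... | J , t′ with anyF⁻ _ t′
  ... | y , t″ with T-∧⁻ {x ⋖ᵇ y} t″
  ... | c , t‴ = J , proj₁ (T-∧⁻ t‴) , y , ⋖⁻ c , proj₂ (T-∧⁻ {x ≤ᵇ κ j} t‴)

  Up⇒𝓤 : ∀ {x j} → ↑.Up x j → ∈𝓤 x j
  Up⇒𝓤 (J , x≤κj , y , c , j≤y) = T-∧⁺ J (anyF⁺ _ y (T-∧⁺ (⋖⁺ c) (T-∧⁺ x≤κj j≤y)))

  𝓓⇒Down : ∀ {x j} → ∈𝓓 x j → ↓.Up x j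
  𝓓⇒Down {x} {j} t with T-∧⁻ {𝓙 j} t
  ... | J , t′ with anyF⁻ _ t′
  ... | y , t″ with T-∧⁻ {y ⋖ᵇ x} t″
  ... | c , t‴ = J , proj₂ (T-∧⁻ {y ≤ᵇ κ j} t‴) , y , Cover-dual (⋖⁻ c) , proj₁ (T-∧⁻ t‴)

  Down⇒𝓓 : ∀ {x j} → ↓.Up x j → ∈𝓓 x j
  Down⇒𝓓 (J , j≤x , y , c , y≤κj) =
    T-∧⁺ J (anyF⁺ _ y (T-∧⁺ (⋖⁺ (Cover-dual⁻ c)) (T-∧⁺ y≤κj j≤x)))

  𝓤⇒𝓙 : ∀ {x j} → ∈𝓤 x j → T (𝓙 j)
  𝓤⇒𝓙 = proj₁ ∘ 𝓤⇒Up

  𝓓⇒𝓙 : ∀ {x j} → ∈𝓓 x j → T (𝓙 j)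
  𝓓⇒𝓙 = proj₁ ∘ 𝓓⇒Down

  greatest-below-𝓤 : ∀ x z → (∀ j → ∈𝓤 x j → z ≤ κ j) → z ≤ x
  greatest-below-𝓤 x z h = Whole↑.greatest-below-Up x z (λ j → h j ∘ Up⇒𝓤)

  least-above-𝓓 : ∀ x z → (∀ j → ∈𝓓 x j → j ≤ z) → x ≤ z
  least-above-𝓓 x z h = Whole↓.greatest-below-Up x z (λ j → h j ∘ Down⇒𝓓)

  T-lookup : ∀ {f : C → Bool} {j} → T (lookup (tabulate f) j) ⇔ T (f j)
  T-lookup {f} {j} = mk⇔ (subst T (VecP.lookup∘tabulate f j)) (subst T (sym (VecP.lookup∘tabulate f j)))

  T-ext : ∀ {b c} → T b ⇔ T c → b ≡ c
  T-ext {true} {true} _ = refl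
  T-ext {false} {false} _ = refl
  T-ext {true} {false} e = ⊥-elim (Equivalence.to e _)
  T-ext {false} {true} e = ⊥-elim (Equivalence.from e _)

  nonadjacent : ∀ {i j} → T (𝓙 i) → T (𝓙 j) → i ≢ j → ¬ T (adj i j) → i ≤ κ j
  nonadjacent {i} {j} Ji Jj i≢j ¬adj = decidable-stable (i ≤? κ j) λ i≰κj →
    ¬adj (Equivalence.from T-∨ (inj₁ (T-∧⁺ {𝓙 i} Ji (T-∧⁺ {𝓙 j} Jj
      (T-∧⁺ (T-not⁺ (i≢j ∘ ==⁻)) (T-not⁺ i≰κj))))))

  arrow⁻ : ∀ {i j} → T (arrow i j) → i ≢ j × ¬ (i ≤ κ j)
  arrow⁻ {i} {j} t =
    let p , q = T-∧⁻ {not (i == j)} (proj₂ (T-∧⁻ {𝓙 j} (proj₂ (T-∧⁻ {𝓙 i} t))))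
    in T-not⁻ p ∘ ==⁺ , T-not⁻ q

  adj⁻ : ∀ {i j} → T (adj i j) → i ≢ j × (¬ (i ≤ κ j) ⊎ ¬ (j ≤ κ i))
  adj⁻ {i} {j} t with Equivalence.to (T-∨ {arrow i j}) t
  ... | inj₁ p = proj₁ (arrow⁻ p) , inj₁ (proj₂ (arrow⁻ p))
  ... | inj₂ p = proj₁ (arrow⁻ p) ∘ sym , inj₂ (proj₂ (arrow⁻ p))

  vertexSet⁻ : ∀ S → T (vertexSet S) → ∀ j → T (lookup S j) → T (𝓙 j)
  vertexSet⁻ S t j Sj with Equivalence.to (T-∨ {not (lookup S j)}) (allF⁻ _ t j)
  ... | inj₁ p = ⊥-elim (T-not⁻ p Sj)
  ... | inj₂ J = J

  independent⁻ : ∀ S → T (independent S) → ↑.Independent (λ j → T (lookup S j))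
  independent⁻ S t i j Si Sj i≢j =
    let vs , ind = T-∧⁻ {vertexSet S} t
    in nonadjacent (vertexSet⁻ S vs i Si) (vertexSet⁻ S vs j Sj) i≢j
         (λ a → T-not⁻ (allF⁻ _ (allF⁻ _ ind i) j) (T-∧⁺ {lookup S i} Si (T-∧⁺ {lookup S j} Sj a)))

  dominating⁺ : ∀ S → T (vertexSet S) →
    (∀ v → T (𝓙 v) → ¬ T (lookup S v) → ¬ (∀ u → T (lookup S u) → ¬ T (adj u v))) → T (dominating S)
  dominating⁺ S vs dom = T-∧⁺ {vertexSet S} vs (allF⁺ _ dom′)
    where
    dom′ : ∀ v → T (not (𝓙 v) Bool.∨ lookup S v Bool.∨ anyF (λ u → lookup S u Bool.∧ adj u v))
    dom′ v with T? (𝓙 v) | T? (lookup S v) | T? (anyF (λ u → lookup S u Bool.∧ adj u v))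
    ... | no ¬J | _ | _ = Equivalence.from T-∨ (inj₁ (T-not⁺ ¬J))
    ... | yes _ | yes p | _ = Equivalence.from (T-∨ {not (𝓙 v)}) (inj₂ (Equivalence.from T-∨ (inj₁ p)))
    ... | yes _ | no _ | yes q =
      Equivalence.from (T-∨ {not (𝓙 v)}) (inj₂ (Equivalence.from (T-∨ {lookup S v}) (inj₂ q)))
    ... | yes J | no ¬p | no ¬q =
      ⊥-elim (dom v J ¬p (λ u Su a → ¬q (anyF⁺ _ u (T-∧⁺ {lookup S u} Su a))))

  dominating⁻ : ∀ S → T (dominating S) → ∀ v → T (𝓙 v) →
                T (lookup S v) ⊎ (∃ λ u → T (lookup S u) × T (adj u v))
  dominating⁻ S t v J with Equivalence.to (T-∨ {not (𝓙 v)}) (allF⁻ _ (proj₂ (T-∧⁻ {vertexSet S} t)) v)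
  ... | inj₁ p = ⊥-elim (T-not⁻ p J)
  ... | inj₂ p with Equivalence.to (T-∨ {lookup S v}) p
  ... | inj₁ q = inj₁ q
  ... | inj₂ q with anyF⁻ _ q
  ... | u , r = inj₂ (u , T-∧⁻ {lookup S u} r)

  𝓓-independent : ∀ x → ↑.Independent (∈𝓓 x)
  𝓓-independent x i j Di Dj =
    independent⁻ (𝓓 x) (𝓓-indep x) i j (Equivalence.from T-lookup Di) (Equivalence.from T-lookup Dj)

  𝓤-independent : ∀ x → ↑.Independent (∈𝓤 x)
  𝓤-independent x i j Ui Uj =
    independent⁻ (𝓤 x) (𝓤-indep x) i j (Equivalence.from T-lookup Ui) (Equivalence.from T-lookup Uj)

  dual-independent : ∀ {I} → ↑.Independent I → ↓.Independent I
  dual-independent ind i j Ii Ij i≢j = ind j i Ij Ii (i≢j ∘ sym)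

  𝓤-realises : (p : C → Bool) → (∀ j → T (p j) → T (𝓙 j)) → ↑.Independent (T ∘ p) →
               ∃ λ x → ∀ j → ∈𝓤 x j ⇔ T (p j)
  𝓤-realises p lab ind =
    let x , e = Whole↑.realise (T ∘ p) (T? ∘ p) lab ind
                  (λ y i j Ui Uj → 𝓤-independent y i j (Up⇒𝓤 Ui) (Up⇒𝓤 Uj))
    in x , λ j → mk⇔ (Equivalence.to (e j) ∘ 𝓤⇒Up) (Up⇒𝓤 ∘ Equivalence.from (e j))

  𝓓-realises : (p : C → Bool) → (∀ j → T (p j) → T (𝓙 j)) → ↑.Independent (T ∘ p) →
               ∃ λ x → ∀ j → ∈𝓓 x j ⇔ T (p j)
  𝓓-realises p lab ind =
    let x , e = Whole↓.realise (T ∘ p) (T? ∘ p) lab (dual-independent ind)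
                  (λ y → dual-independent (λ i j Di Dj → 𝓓-independent y i j (Down⇒𝓓 Di) (Down⇒𝓓 Dj)))
    in x , λ j → mk⇔ (Equivalence.to (e j) ∘ 𝓓⇒Down) (Down⇒𝓓 ∘ Equivalence.from (e j))

  -- The independent set `𝓓 x` is realised as some `𝓤 y`, so the search succeeds and never falls
  -- back on its default value.
  𝓤Row≡𝓓 : ∀ x → 𝓤 (Row x) ≡ 𝓓 x
  𝓤Row≡𝓓 x =
    let y , e = 𝓤-realises (𝓓ᵇ x) (λ _ → 𝓓⇒𝓙) (𝓓-independent x)
    in subst (λ r → 𝓤 r ≡ 𝓓 x) (search-elems x)
         (search-finds x elems (lose (∈-allFin y) (VecP.tabulate-cong (T-ext ∘ e))))

  𝓤Row⇔𝓓 : ∀ x j → ∈𝓤 (Row x) j ⇔ ∈𝓓 x j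
  𝓤Row⇔𝓓 x j = mk⇔
    (Equivalence.to T-lookup ∘ subst (λ S → T (lookup S j)) (𝓤Row≡𝓓 x) ∘ Equivalence.from T-lookup)
    (Equivalence.to T-lookup ∘ subst (λ S → T (lookup S j)) (sym (𝓤Row≡𝓓 x)) ∘ Equivalence.from T-lookup)

  Row≤κ : ∀ {x j} → ∈𝓓 x j → Row x ≤ κ j
  Row≤κ {x} {j} d = proj₁ (proj₂ (𝓤⇒Up (Equivalence.from (𝓤Row⇔𝓓 x j) d)))

  -- Together with `Row≤κ` this identifies `Row x` as the meet of `κ` over `𝓓 x`.
  ≤Row : ∀ x z → (∀ j → ∈𝓓 x j → z ≤ κ j) → z ≤ Row x
  ≤Row x z h = greatest-below-𝓤 (Row x) z (λ j → h j ∘ Equivalence.to (𝓤Row⇔𝓓 x j))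

  𝓓≤ : ∀ {x j} → ∈𝓓 x j → j ≤ x
  𝓓≤ d = proj₁ (proj₂ (𝓓⇒Down d))

  Row-injective : ∀ x y → Row x ≡ Row y → x ≡ y
  Row-injective x y e = antisym (half x y e) (half y x (sym e))
    where
    half : ∀ x y → Row x ≡ Row y → x ≤ y
    half x y e = least-above-𝓓 x y (λ j d → 𝓓≤ (Equivalence.to (𝓤Row⇔𝓓 y j)
      (subst (λ r → ∈𝓤 r j) e (Equivalence.from (𝓤Row⇔𝓓 x j) d))))

  Pop↓-isMeet : ∀ x → ↑.IsMeet x (∈𝓓 x) (Pop↓ x)
  Pop↓-isMeet x = record
    { below = M.below
    ; below-hi = λ d → M.below-hi
        (let J , j≤x , y , c , y≤κj = 𝓓⇒Down d in J , j≤x , y , Cover-dual⁻ c , y≤κj)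
    ; greatest = λ z z≤x h → M.greatest z z≤x
        (λ j (J , j≤x , y , c , y≤κj) → h j (Down⇒𝓓 (J , j≤x , y , Cover-dual c , y≤κj))) }
    where
    module M = ↑.IsMeet (Whole↑.meet-of-lower-covers x (filterᵇ (λ y → y ⋖ᵇ x) elems)
      (λ y → mk⇔ (⋖⁻ ∘ proj₂ ∘ ∈-filter⁻ (λ y → T? (y ⋖ᵇ x)) {xs = elems})
                 (∈-filter⁺ (λ y → T? (y ⋖ᵇ x)) (∈-allFin y) ∘ ⋖⁺)))

  Pop↑-isJoin : ∀ x → ↓.IsMeet x (∈𝓤 x) (Pop↑ x)
  Pop↑-isJoin x = record
    { below = M.below
    ; below-hi = λ d → M.below-hi
        (let J , x≤κj , y , c , j≤y = 𝓤⇒Up d in J , x≤κj , y , Cover-dual c , j≤y)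
    ; greatest = λ z x≤z h → M.greatest z x≤z
        (λ j (J , x≤κj , y , c , j≤y) → h j (Up⇒𝓤 (J , x≤κj , y , Cover-dual⁻ c , j≤y))) }
    where
    module M = ↓.IsMeet (Whole↓.meet-of-lower-covers x (filterᵇ (λ y → x ⋖ᵇ y) elems)
      (λ y → mk⇔ (Cover-dual ∘ ⋖⁻ ∘ proj₂ ∘ ∈-filter⁻ (λ y → T? (x ⋖ᵇ y)) {xs = elems})
                 (∈-filter⁺ (λ y → T? (x ⋖ᵇ y)) (∈-allFin y) ∘ ⋖⁺ ∘ Cover-dual⁻)))

  𝓓⊆𝓤Pop↓ : ∀ x j → ∈𝓓 x j → ∈𝓤 (Pop↓ x) j
  𝓓⊆𝓤Pop↓ x j d = Up⇒𝓤 (Whole↑.independent⊆Up (∈𝓓 x) (λ i → T? (𝓓ᵇ x i)) (λ _ → 𝓓⇒𝓙)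
    (𝓓-independent x) x (Pop↓ x) (λ _ → 𝓓≤) (Pop↓-isMeet x) j d)

  𝓤⊆𝓓Pop↑ : ∀ x j → ∈𝓤 x j → ∈𝓓 (Pop↑ x) j
  𝓤⊆𝓓Pop↑ x j u = Down⇒𝓓 (Whole↓.independent⊆Up (∈𝓤 x) (λ i → T? (𝓤ᵇ x i)) (λ _ → 𝓤⇒𝓙)
    (dual-independent (𝓤-independent x)) x (Pop↑ x) (λ _ → proj₁ ∘ proj₂ ∘ 𝓤⇒Up) (Pop↑-isJoin x) j u)

  Row≤⇒indDom : ∀ x → Row x ≤ x → T (indDom (𝓓 x))
  Row≤⇒indDom x r≤x = T-∧⁺ {independent (𝓓 x)} (𝓓-indep x)
    (dominating⁺ (𝓓 x) (proj₁ (T-∧⁻ {vertexSet (𝓓 x)} (𝓓-indep x))) dom)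
    where
    dom : ∀ v → T (𝓙 v) → ¬ T (lookup (𝓓 x) v) → ¬ (∀ u → T (lookup (𝓓 x) u) → ¬ T (adj u v))
    -- The contradiction is the chain `v ≤ Row x ≤ x ≤ κ v`.
    dom v Jv v∉ none = j≰κj v Jv (≤Row x v v≤κ ⨾ r≤x ⨾ least-above-𝓓 x (κ v) ≤κv)
      where
      ≢v : ∀ {d} → ∈𝓓 x d → d ≢ v
      ≢v Dd refl = v∉ (Equivalence.from T-lookup Dd)
      ¬adj : ∀ {d} → ∈𝓓 x d → ¬ T (adj d v)
      ¬adj Dd = none _ (Equivalence.from T-lookup Dd)
      ≤κv : ∀ d → ∈𝓓 x d → d ≤ κ v
      ≤κv d Dd = nonadjacent (𝓓⇒𝓙 Dd) Jv (≢v Dd) (¬adj Dd)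
      v≤κ : ∀ d → ∈𝓓 x d → v ≤ κ d
      v≤κ d Dd = nonadjacent Jv (𝓓⇒𝓙 Dd) (≢v Dd ∘ sym)
        (¬adj Dd ∘ Equivalence.from (T-∨ {arrow d v}) ∘ swap ∘ Equivalence.to (T-∨ {arrow v d}))

  -- 𝓤(Pop↓ x) is independent and contains the maximal independent set 𝓓(x) = 𝓤(Row x).
  indDom⇒Row≤ : ∀ x → T (indDom (𝓓 x)) → Row x ≤ x
  indDom⇒Row≤ x t =
    greatest-below-𝓤 (Pop↓ x) (Row x) (λ j → Row≤κ ∘ 𝓤⊆𝓓 j) ⨾ ↑.IsMeet.below (Pop↓-isMeet x)
    where
    𝓤⊆𝓓 : ∀ j → ∈𝓤 (Pop↓ x) j → ∈𝓓 x j
    𝓤⊆𝓓 j u = [ Equivalence.to T-lookup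
                , (λ (i , Si , a) →
                    ⊥-elim (no-neighbour (𝓓⊆𝓤Pop↓ x i (Equivalence.to T-lookup Si)) (adj⁻ a))) ]′
                (dominating⁻ (𝓓 x) (proj₂ (T-∧⁻ {independent (𝓓 x)} t)) j (𝓤⇒𝓙 u))
      where
      no-neighbour : ∀ {i} → ∈𝓤 (Pop↓ x) i → ¬ (i ≢ j × (¬ (i ≤ κ j) ⊎ ¬ (j ≤ κ i)))
      no-neighbour Ui (i≢j , inj₁ ¬p) = ¬p (𝓤-independent (Pop↓ x) _ j Ui u i≢j)
      no-neighbour Ui (i≢j , inj₂ ¬p) = ¬p (𝓤-independent (Pop↓ x) j _ u Ui (i≢j ∘ sym))

  Row≤⇔indDom : ∀ x → (Row x ≤ x) ⇔ T (indDom (𝓓 x))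
  Row≤⇔indDom x = mk⇔ (Row≤⇒indDom x) (indDom⇒Row≤ x)

  -- `Pop↑ (Row x)` is the join of `Row x` with `𝓤 (Row x) = 𝓓 x`, and `x` is the join of `𝓓 x`.
  Pop↑Row : ∀ x → Row x ≤ x → Pop↑ (Row x) ≡ x
  Pop↑Row x r≤x = antisym
    (↓.IsMeet.greatest (Pop↑-isJoin (Row x)) x r≤x (λ j → 𝓓≤ ∘ Equivalence.to (𝓤Row⇔𝓓 x j)))
    (least-above-𝓓 x (Pop↑ (Row x))
      (λ j d → ↓.IsMeet.below-hi (Pop↑-isJoin (Row x)) (Equivalence.from (𝓤Row⇔𝓓 x j) d)))

  -- As `𝓤 z` lies in `𝓓 (Pop↑ z)`, the meet defining `Row (Pop↑ z)` is below that of `κ` over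
  -- `𝓤 z`, which is `z`.
  RowPop↑≤ : ∀ z → Row (Pop↑ z) ≤ Pop↑ z
  RowPop↑≤ z = greatest-below-𝓤 z (Row (Pop↑ z)) (λ j → Row≤κ ∘ 𝓤⊆𝓓Pop↑ z j)
               ⨾ ↓.IsMeet.below (Pop↑-isJoin z)

  Pop↓≡Row : ∀ x → Row x ≤ x → Pop↓ x ≡ Row x
  Pop↓≡Row x r≤x = antisym
    (≤Row x (Pop↓ x) (λ j → ↑.IsMeet.below-hi (Pop↓-isMeet x)))
    (↑.IsMeet.greatest (Pop↓-isMeet x) (Row x) r≤x (λ j → Row≤κ))

  -- Choose `x` with `𝓓 x = 𝓤 (Pop↓ z)`; both `Row x` and `Pop↓ z` are then the meet of `κ` over
  -- this set. It contains `𝓓 z`, whose join is `z`, so `Pop↓ z ≤ z ≤ x`.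
  Pop↓-is-Row : ∀ z → ∃ λ x → (Row x ≤ x) × Row x ≡ Pop↓ z
  Pop↓-is-Row z =
    let x , e = 𝓓-realises (𝓤ᵇ (Pop↓ z)) (λ _ → 𝓤⇒𝓙) (𝓤-independent (Pop↓ z))
        Row≡ = antisym
          (greatest-below-𝓤 (Pop↓ z) (Row x) (λ j → Row≤κ ∘ Equivalence.from (e j)))
          (≤Row x (Pop↓ z) (λ j → proj₁ ∘ proj₂ ∘ 𝓤⇒Up ∘ Equivalence.to (e j)))
        z≤x = least-above-𝓓 z x (λ j → 𝓓≤ ∘ Equivalence.from (e j) ∘ 𝓓⊆𝓤Pop↓ z j)
    in x , (≡⇒≤ Row≡ ⨾ ↑.IsMeet.below (Pop↓-isMeet z) ⨾ z≤x) , Row≡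

  -- Comparison of the cardinalities.

  #Row≤ : ℕ
  #Row≤ = countᵇ (λ x → Row x ≤ᵇ x) elems

  -- The two sets coincide, so no bijection intervenes.
  #Row≤≡#Pop↑ : #Row≤ ≡ #Pop↑
  #Row≤≡#Pop↑ = countᵇ-cong (λ x → mk⇔
    (λ r≤x → anyF⁺ (λ z → Pop↑ z == x) (Row x) (==⁺ (Pop↑Row x r≤x)))
    (λ t → let z , e = anyF⁻ (λ z → Pop↑ z == x) t
           in subst (λ y → Row y ≤ y) (==⁻ e) (RowPop↑≤ z))) elems

  -- Here the bijection is `Row` itself, which agrees with `Pop↓` on the elements counted.
  #Row≤≡#Pop↓ : #Row≤ ≡ #Pop↓
  #Row≤≡#Pop↓ = countᵇ-bijection Row (Unique.allFin⁺ _) (Unique.allFin⁺ _) ∈-allFin ∈-allFin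
    (λ x r≤x → anyF⁺ (λ z → Pop↓ z == Row x) x (==⁺ (Pop↓≡Row x r≤x)))
    Row-injective
    (λ y t → let z , e = anyF⁻ (λ z → Pop↓ z == y) t
                 x , r≤x , Row≡ = Pop↓-is-Row z
             in x , r≤x , trans Row≡ (==⁻ e))

  #Row≤≡#IndDom : #Row≤ ≡ countᵇ indDom (allSubsets n)
  #Row≤≡#IndDom = countᵇ-bijection 𝓓 (Unique.allFin⁺ _) (allSubsets-unique _) ∈-allFin ∈-allSubsets
    Row≤⇒indDom 𝓓-injective onto
    where
    𝓓-injective : ∀ x y → 𝓓 x ≡ 𝓓 y → x ≡ y
    𝓓-injective x y e = antisym (half x y e) (half y x (sym e))
      where
      half : ∀ x y → 𝓓 x ≡ 𝓓 y → x ≤ y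
      half x y e = least-above-𝓓 x y (λ j d → 𝓓≤ (Equivalence.to T-lookup
        (subst (λ S → T (lookup S j)) e (Equivalence.from T-lookup d))))
    onto : ∀ S → T (indDom S) → ∃ λ x → (Row x ≤ x) × 𝓓 x ≡ S
    onto S t =
      let ind = proj₁ (T-∧⁻ {independent S} t)
          x , e = 𝓓-realises (lookup S) (vertexSet⁻ S (proj₁ (T-∧⁻ {vertexSet S} ind)))
                    (independent⁻ S ind)
          𝓓x≡S = trans (VecP.tabulate-cong (T-ext ∘ e)) (VecP.tabulate∘lookup S)
      in x , indDom⇒Row≤ x (subst (T ∘ indDom) (sym 𝓓x≡S) t) , 𝓓x≡S

theorem9p13 : (L : FiniteLattice) (sd : Semidistrim L) →
    let open SemidistrimTheory L sd in
    (∀ x → (Row x ≤ x) ⇔ T (indDom (𝓓 x)))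
    × (#RowLe ≡ #Pop↓ × #Pop↓ ≡ #Pop↑ × #Pop↑ ≡ #IndDom)
theorem9p13 L sd =
  Row≤⇔indDom , #Row≤≡#Pop↓ , trans (sym #Row≤≡#Pop↓) #Row≤≡#Pop↑ ,
  trans (sym #Row≤≡#Pop↑) #Row≤≡#IndDom
  where
  open Semidistrim sd
  open Rowmotion L κL (λ j → Reflection.Pairing.j≰κj L (proj₁ (proj₂ (LatticeTheory.cdPaired L cd))))
    (Reflection.whole-dismantling L cd) 𝓓-indep 𝓤-indep
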